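{- Let $R$ be an order in $K$. For every over-order $S$ of $R$, the action of $\mathrm{Pic}(S)$ on $\mathrm{ICM}_S(R)$ induced by ideal multiplication is free, and $$\mathcal{W}_S(R)=\mathrm{ICM}_S(R)/\mathrm{Pic}(S)$$ (that is, two classes $\{I\},\{I'\}\in \mathrm{ICM}_S(R)$ lie in the same $\mathrm{Pic}(S)$-orbit if and only if $[I]=[I']$). More concretely, if $$\mathcal{W}_S(R)=\{[I_1],\ldots,[I_r]\}\quad\text{and}\quad \mathrm{Pic}(S)=\{\{J_1\},\ldots,\{J_s\}\},$$ with the $I_i$'s pairwise not weakly equivalent and the $J_j$'s pairwise not isomorphic, then $$\mathrm{ICM}_S(R)=\{\{I_iJ_j\} : 1\le i\le r,\ 1\le j\le s\}$$ and the fractional ideals $I_iJ_j$ are pairwise not isomorphic.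
   Context: An order is a commutative reduced ring $R$ with unit that is free and finitely generated as a $\mathbb{Z}$-module; its total quotient ring $K$ is a finite product of number fields, and $R$ is called an order in $K$. A fractional $R$-ideal is a finitely generated sub-$R$-module $I$ of $K$ with $I\otimes_{\mathbb{Z}}\mathbb{Q}=K$ (i.e. $I$ spans $K$ over $\mathbb{Q}$). For fractional $R$-ideals $I,J$, $IJ$ is the usual product and $(I:J)=\{x\in K: xJ\subseteq I\}$. An over-order of $R$ is a fractional $R$-ideal that is a subring of $K$ (so it contains $R$). The multiplicator ring of $I$ is $(I:I)$, which is an over-order of $R$. A fractional $R$-ideal $I$ is invertible if $IJ=R$ for some fractional $R$-ideal $J$. Two fractional $R$-ideals are isomorphic (as $R$-modules) if and only if $I=\alpha J$ for some $\alpha\in K^\times$; the isomorphism class of $I$ is denoted $\{I\}$. $\mathrm{ICM}(R)$ is the commutative monoid (under ideal multiplication) of isomorphism classes of fractional $R$-ideals, and $\mathrm{Pic}(S)$ is the group of isomorphism classes of invertible fractional $S$-ideals. Two fractional $R$-ideals $I,J$ are weakly equivalent if they satisfy the following equivalent conditions: $I_{\mathfrak p}\simeq J_{\mathfrak p}$ as $R_{\mathfrak p}$-modules for every maximal ideal $\mathfrak p$ of $R$; $1\in (I:J)(J:I)$; $I$ and $J$ have the same multiplicator ring $S$ and $I=LJ$ for some invertible fractional $S$-ideal $L$. The weak equivalence class of $I$ is denoted $[I]$. For an over-order $S$ of $R$, $\mathrm{ICM}_S(R)$ is the set of isomorphism classes $\{I\}$ of fractional $R$-ideals with $(I:I)=S$,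 and $\mathcal{W}_S(R)$ is the set of weak equivalence classes $[I]$ of fractional $R$-ideals with $(I:I)=S$. -}

module Defs where

open import Algebra.Bundles using (CommutativeRing; Group; Semiring)
open import Algebra.Module.Bundles.Raw using (RawLeftModule)
open import Algebra.Module.Morphism.Structures using (module LeftModuleMorphisms)
import Algebra.Definitions.RawMonoid as RawMonoidDefinitions
import Algebra.Definitions.RawSemiring as RawSemiringDefinitions
import Algebra.Properties.CommutativeSemigroup as CommutativeSemigroupProperties
import Algebra.Properties.CommutativeMonoid.Sum as SumProperties
import Algebra.Properties.Monoid.Mult as MultProperties
import Algebra.Properties.Ring as RingProperties
import Algebra.Properties.Semiring.Mult as SemiringMultProperties
open import Data.Fin.Base using (Fin; zero; suc; combine; remQuot; splitAt)
open import Data.Fin.Properties using (remQuot-combine)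
open import Data.Integer.Base as ℤ using (ℤ; +_; -[1+_]; 0ℤ)
import Data.Integer.Properties as ℤₚ
open import Data.Nat.Base as ℕ using (ℕ; NonZero)
import Data.Nat.Properties as ℕₚ
open import Data.Product.Base using (Σ-syntax; ∃; _×_; _,_; proj₁; proj₂)
open import Data.Sum.Base using (inj₁; inj₂)
open import Data.Vec.Functional using (Vector; []; _∷_; _++_; tail)
open import Function.Base using (_∘_; id)
open import Level using (Level; _⊔_)
import Level
open import Relation.Binary.Bundles using (Setoid)
open import Relation.Binary.Definitions using (_Respects_)
open import Relation.Binary.PropositionalEquality.Core as ≡ using (_≡_; _≢_)
import Relation.Binary.Reasoning.Setoid as SetoidReasoning
open import Relation.Nullary.Negation.Core using (¬_)
open import Relation.Unary using (Pred; _∈_; _⊆_; _≐_)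

module _ {g ℓg x ℓx : Level} (G : Group g ℓg) (X : Setoid x ℓx) where
  private
    module G = Group G
    module X = Setoid X

  record GroupAction : Set (g ⊔ ℓg ⊔ x ⊔ ℓx) where
    infixr 7 _▷_
    field
      _▷_      : G.Carrier → X.Carrier → X.Carrier
      ▷-cong   : ∀ {g h x y} → g G.≈ h → x X.≈ y → (g ▷ x) X.≈ (h ▷ y)
      identity : ∀ x → (G.ε ▷ x) X.≈ x
      compat   : ∀ g h x → ((g G.∙ h) ▷ x) X.≈ (g ▷ (h ▷ x))

    Free : Set (g ⊔ ℓg ⊔ x ⊔ ℓx)
    Free = ∀ g x → (g ▷ x) X.≈ x → g G.≈ G.ε

    SameOrbit : X.Carrier → X.Carrier → Set (g ⊔ ℓx)
    SameOrbit x y = ∃ λ g → (g ▷ x) X.≈ y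

-- `f` lists the elements of the quotient of X by its equality, without repetition.
record Enumerates {x ℓx i} (X : Setoid x ℓx) {I : Set i} (f : I → Setoid.Carrier X)
       : Set (x ⊔ ℓx ⊔ i) where
  open Setoid X
  field
    complete : ∀ x → ∃ λ i → f i ≈ x
    distinct : ∀ {i j} → i ≢ j → ¬ f i ≈ f j

module _ {c ℓ : Level} (K : CommutativeRing c ℓ) where
  open CommutativeRing K hiding (zero)
  open RawMonoidDefinitions +-rawMonoid using (sum) renaming (_×_ to _×ℕ_)
  open RawSemiringDefinitions (Semiring.rawSemiring semiring) using (_^_)

  infixr 8 _×ℤ_
  _×ℤ_ : ℤ → Carrier → Carrier
  (+ n)    ×ℤ x = n ×ℕ x
  -[1+ n ] ×ℤ x = - (ℕ.suc n ×ℕ x)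

  record Subring : Set (Level.suc (c ⊔ ℓ)) where
    field
      carrier  : Pred Carrier (c ⊔ ℓ)
      resp     : carrier Respects _≈_
      0∈       : 0# ∈ carrier
      1∈       : 1# ∈ carrier
      +-closed : ∀ {x y} → x ∈ carrier → y ∈ carrier → x + y ∈ carrier
      *-closed : ∀ {x y} → x ∈ carrier → y ∈ carrier → x * y ∈ carrier
      -‿closed : ∀ {x} → x ∈ carrier → - x ∈ carrier

    Reduced : Set (c ⊔ ℓ)
    Reduced = ∀ {x} → x ∈ carrier → ∀ n → x ^ n ≈ 0# → x ≈ 0#

    IsBasis : ∀ {n} → Vector Carrier n → Set (c ⊔ ℓ)
    IsBasis {n} e =
      (∀ i → e i ∈ carrier) ×
      (∀ {x} → x ∈ carrier → Σ[ z ∈ Vector ℤ n ] x ≈ sum (λ i → z i ×ℤ e i)) ×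
      (∀ (z : Vector ℤ n) → sum (λ i → z i ×ℤ e i) ≈ 0# → ∀ i → z i ≡ 0ℤ)

    FreeOfFiniteRank : Set (c ⊔ ℓ)
    FreeOfFiniteRank = ∃ λ n → Σ[ e ∈ Vector Carrier n ] IsBasis e

    Regular : Pred Carrier (c ⊔ ℓ)
    Regular b = b ∈ carrier × (∀ {y} → y ∈ carrier → b * y ≈ 0# → y ≈ 0#)

    -- K is, up to isomorphism over the subring, its localization at the regular elements.
    HasTotalQuotientRing : Set (c ⊔ ℓ)
    HasTotalQuotientRing =
      (∀ {b} → Regular b → ∃ λ b⁻¹ → b * b⁻¹ ≈ 1#) ×
      (∀ x → ∃ λ b → Regular b × b * x ∈ carrier)

  -- That K is a finite product of number fields is a consequence of these axioms.
  record Order : Set (Level.suc (c ⊔ ℓ)) where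
    field
      subring           : Subring
    open Subring subring public
    field
      reduced           : Reduced
      freeOfFiniteRank  : FreeOfFiniteRank
      totalQuotientRing : HasTotalQuotientRing

module _ {c ℓ : Level} {K : CommutativeRing c ℓ} where
  open CommutativeRing K hiding (zero)
  open RawMonoidDefinitions +-rawMonoid using (sum) renaming (_×_ to _×ℕ_)
  open RingProperties ring using (-1*x≈-x; -‿distribʳ-*)
  open CommutativeSemigroupProperties *-commutativeSemigroup
    using (interchange; x∙yz≈y∙xz)
  open MultProperties +-monoid using (×-congʳ)
  open SemiringMultProperties semiring using (×1-homo-*; ×-assoc-*)
  open SumProperties +-commutativeMonoid using (sum-cong-≋)
  open SetoidReasoning setoid

  KPred : Set (Level.suc (c ⊔ ℓ))
  KPred = Pred Carrier (c ⊔ ℓ)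

  infixl 7 _·_
  infix  6 _∶_

  record _·_ (P Q : KPred) (x : Carrier) : Set (c ⊔ ℓ) where
    constructor finiteSum
    field
      {terms} : ℕ
      a b     : Vector Carrier terms
      a∈      : ∀ i → a i ∈ P
      b∈      : ∀ i → b i ∈ Q
      x≈Σab   : x ≈ sum (λ i → a i * b i)

  _∶_ : KPred → KPred → KPred
  (P ∶ Q) x = ∀ y → y ∈ Q → x * y ∈ P

  Span : ∀ {n} → KPred → Vector Carrier n → KPred
  Span {n} A g x = Σ[ a ∈ Vector Carrier n ] (∀ i → a i ∈ A) × x ≈ sum (λ i → a i * g i)

  -- Over an arbitrary subring, so that it applies both to an order and to its over-orders.
  record FractionalIdeal (A : Subring K) : Set (Level.suc (c ⊔ ℓ)) where
    private module A = Subring A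
    field
      carrier  : KPred
      resp     : carrier Respects _≈_
      0∈       : 0# ∈ carrier
      +-closed : ∀ {x y} → x ∈ carrier → y ∈ carrier → x + y ∈ carrier
      *-closed : ∀ {a x} → a ∈ A.carrier → x ∈ carrier → a * x ∈ carrier
      finitelyGenerated : ∃ λ n → Σ[ g ∈ Vector Carrier n ]
        (∀ i → g i ∈ carrier) × carrier ⊆ Span A.carrier g
      -- x is a ℚ-linear combination of elements of the ideal iff, clearing
      -- denominators, some nonzero integer multiple of x lies in it.
      spansℚ : ∀ x → ∃ λ n → NonZero n × n ×ℕ x ∈ carrier

    -‿closed : ∀ {x} → x ∈ carrier → - x ∈ carrier
    -‿closed x∈ = resp (-1*x≈-x _) (*-closed (A.-‿closed A.1∈) x∈)

    rawLeftModule : RawLeftModule (∃ A.carrier) (c ⊔ ℓ) ℓ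
    rawLeftModule = record
      { Carrierᴹ = ∃ carrier
      ; _≈ᴹ_     = λ x y → proj₁ x ≈ proj₁ y
      ; _+ᴹ_     = λ (x , x∈) (y , y∈) → x + y , +-closed x∈ y∈
      ; _*ₗ_     = λ (a , a∈) (x , x∈) → a * x , *-closed a∈ x∈
      ; 0ᴹ       = 0# , 0∈
      ; -ᴹ_      = λ (x , x∈) → - x , -‿closed x∈
      }

  ∣_∣ : ∀ {A} → FractionalIdeal A → KPred
  ∣ I ∣ = FractionalIdeal.carrier I

  -- Isomorphism as A-modules; `≅⇒Scaling` and `Scaling⇒≅` identify it with
  -- I = α J for a unit α of K.
  infix 4 _≅_
  _≅_ : ∀ {A} → FractionalIdeal A → FractionalIdeal A → Set (c ⊔ ℓ)
  I ≅ J = ∃ (LeftModuleMorphisms.IsLeftModuleIsomorphism I.rawLeftModule J.rawLeftModule)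
    where
    module I = FractionalIdeal I
    module J = FractionalIdeal J

  -- Weak equivalence, in its global form 1 ∈ (I : J)(J : I).
  infix 4 _~_
  _~_ : ∀ {A} → FractionalIdeal A → FractionalIdeal A → Set (c ⊔ ℓ)
  I ~ J = 1# ∈ (∣ I ∣ ∶ ∣ J ∣) · (∣ J ∣ ∶ ∣ I ∣)

  multiplicatorRing : ∀ {A} → FractionalIdeal A → KPred
  multiplicatorRing I = ∣ I ∣ ∶ ∣ I ∣

  record InvertibleIdeal (A : Subring K) : Set (Level.suc (c ⊔ ℓ)) where
    field
      ideal    : FractionalIdeal A
      inverse  : FractionalIdeal A
    open FractionalIdeal ideal public
    field
      isInverse : ∣ ideal ∣ · ∣ inverse ∣ ≐ Subring.carrier A

  record OverOrder (R : Order K) : Set (Level.suc (c ⊔ ℓ)) where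
    field
      ideal    : FractionalIdeal (Order.subring R)
    open FractionalIdeal ideal public renaming (*-closed to *-closedᴿ)
    field
      1∈       : 1# ∈ carrier
      *-closed : ∀ {x y} → x ∈ carrier → y ∈ carrier → x * y ∈ carrier

    subring : Subring K
    subring = record
      { carrier  = carrier
      ; resp     = resp
      ; 0∈       = 0∈
      ; 1∈       = 1∈
      ; +-closed = +-closed
      ; *-closed = *-closed
      ; -‿closed = -‿closed
      }

    R⊆ : Order.carrier R ⊆ carrier
    R⊆ r∈ = resp (*-identityʳ _) (*-closedᴿ r∈ 1∈)

  record Additive (T : KPred) : Set (c ⊔ ℓ) where
    field
      resp     : T Respects _≈_
      0∈       : 0# ∈ T
      +-closed : ∀ {x y} → x ∈ T → y ∈ T → x + y ∈ T

  ideal-additive : ∀ {A} (I : FractionalIdeal A) → Additive ∣ I ∣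
  ideal-additive I = record { resp = I.resp ; 0∈ = I.0∈ ; +-closed = I.+-closed }
    where module I = FractionalIdeal I

  subring-additive : (A : Subring K) → Additive (Subring.carrier A)
  subring-additive A = record { resp = A.resp ; 0∈ = A.0∈ ; +-closed = A.+-closed }
    where module A = Subring A

  multiples-additive : ∀ {T} → Additive T → ∀ y → Additive (λ x → x * y ∈ T)
  multiples-additive T y = record
    { resp     = λ x≈x′ → T.resp (*-congʳ x≈x′)
    ; 0∈       = T.resp (sym (zeroˡ y)) T.0∈
    ; +-closed = λ x∈ x′∈ → T.resp (sym (distribʳ y _ _)) (T.+-closed x∈ x′∈)
    }
    where module T = Additive T

  sum-closed : ∀ {T} → Additive T → ∀ {n} (v : Vector Carrier n) →
               (∀ i → v i ∈ T) → sum v ∈ T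
  sum-closed T {ℕ.zero}  v v∈ = Additive.0∈ T
  sum-closed T {ℕ.suc n} v v∈ =
    Additive.+-closed T (v∈ zero) (sum-closed T (tail v) (v∈ ∘ suc))

  sum-++ : ∀ {m n} (v : Vector Carrier m) (w : Vector Carrier n)
           (v′ : Vector Carrier m) (w′ : Vector Carrier n) →
           sum (λ i → v i * v′ i) + sum (λ i → w i * w′ i) ≈
           sum (λ i → (v ++ w) i * (v′ ++ w′) i)
  sum-++ {ℕ.zero}  v w v′ w′ = +-identityˡ _
  sum-++ {ℕ.suc m} v w v′ w′ = trans (+-assoc _ _ _)
    (+-congˡ (trans (sum-++ (tail v) w (tail v′) w′) (sum-cong-≋ step)))
    where
    step : ∀ i → (tail v ++ w) i * (tail v′ ++ w′) i ≈ (v ++ w) (suc i) * (v′ ++ w′) (suc i)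
    step i with splitAt m i
    ... | inj₁ _ = refl
    ... | inj₂ _ = refl

  ++-all : ∀ {P : KPred} {m n} (v : Vector Carrier m) (w : Vector Carrier n) →
           (∀ i → v i ∈ P) → (∀ i → w i ∈ P) → ∀ i → (v ++ w) i ∈ P
  ++-all {m = m} v w v∈ w∈ i with splitAt m i
  ... | inj₁ j = v∈ j
  ... | inj₂ j = w∈ j

  ·-additive : ∀ {P Q} → Additive (P · Q)
  ·-additive {P} {Q} = record
    { resp     = λ x≈y (finiteSum a b a∈ b∈ eq) → finiteSum a b a∈ b∈ (trans (sym x≈y) eq)
    ; 0∈       = finiteSum [] [] (λ ()) (λ ()) refl
    ; +-closed = λ (finiteSum a b a∈ b∈ eq) (finiteSum a′ b′ a′∈ b′∈ eq′) →
        finiteSum (a ++ a′) (b ++ b′) (++-all {P} a a′ a∈ a′∈) (++-all {Q} b b′ b∈ b′∈)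
          (trans (+-cong eq eq′) (sum-++ a a′ b b′))
    }

  ·-intro : ∀ {P Q x y} → x ∈ P → y ∈ Q → x * y ∈ P · Q
  ·-intro x∈ y∈ = finiteSum (λ _ → _) (λ _ → _) (λ (_ : Fin 1) → x∈) (λ _ → y∈) (sym (+-identityʳ _))

  ·-elim : ∀ {P Q T} → Additive T → (∀ {x y} → x ∈ P → y ∈ Q → x * y ∈ T) → P · Q ⊆ T
  ·-elim T f (finiteSum a b a∈ b∈ eq) =
    Additive.resp T (sym eq) (sum-closed T _ (λ i → f (a∈ i) (b∈ i)))

  ·-mono : ∀ {P P′ Q Q′} → P ⊆ P′ → Q ⊆ Q′ → P · Q ⊆ P′ · Q′
  ·-mono f g (finiteSum a b a∈ b∈ eq) = finiteSum a b (f ∘ a∈) (g ∘ b∈) eq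

  ·-comm : ∀ {P Q} → P · Q ⊆ Q · P
  ·-comm = ·-elim ·-additive
    (λ x∈ y∈ → Additive.resp ·-additive (*-comm _ _) (·-intro y∈ x∈))

  ·-assocʳ : ∀ {P Q T} → (P · Q) · T ⊆ P · (Q · T)
  ·-assocʳ = ·-elim ·-additive λ {_} {z} w∈ z∈ →
    ·-elim (multiples-additive ·-additive z)
      (λ x∈ y∈ → Additive.resp ·-additive (sym (*-assoc _ _ _)) (·-intro x∈ (·-intro y∈ z∈)))
      w∈

  ·-assocˡ : ∀ {P Q T} → P · (Q · T) ⊆ (P · Q) · T
  ·-assocˡ = ·-comm ∘ ·-mono id ·-comm ∘ ·-assocʳ ∘ ·-mono ·-comm id ∘ ·-comm

  Span-additive : (A : Subring K) → ∀ {n} (g : Vector Carrier n) →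
                  Additive (Span (Subring.carrier A) g)
  Span-additive A g = record
    { resp     = λ x≈y (a , a∈ , eq) → a , a∈ , trans (sym x≈y) eq
    ; 0∈       = (λ _ → 0#) , (λ _ → A.0∈) , sym (sum-zero g)
    ; +-closed = λ (a , a∈ , eq) (b , b∈ , eq′) →
        (λ i → a i + b i) , (λ i → A.+-closed (a∈ i) (b∈ i)) ,
        trans (+-cong eq eq′) (sym (trans (sum-cong-≋ (λ i → distribʳ (g i) (a i) (b i)))
          (∑-distrib-+ (λ i → a i * g i) (λ i → b i * g i))))
    }
    where
    module A = Subring A
    open SumProperties +-commutativeMonoid using (∑-distrib-+)
    sum-zero : ∀ {n} (g : Vector Carrier n) → sum (λ i → 0# * g i) ≈ 0#
    sum-zero {ℕ.zero}  g = refl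
    sum-zero {ℕ.suc n} g = trans (+-cong (zeroˡ _) (sum-zero (tail g))) (+-identityˡ _)

  Span-generator : (A : Subring K) → ∀ {n} (g : Vector Carrier n) {a} →
                   a ∈ Subring.carrier A → ∀ i → a * g i ∈ Span (Subring.carrier A) g
  Span-generator A g {a} a∈ zero =
    let b , b∈ , eq = Additive.0∈ (Span-additive A (tail g))
    in a ∷ b , (λ { zero → a∈ ; (suc i) → b∈ i }) , trans (sym (+-identityʳ _)) (+-congˡ eq)
  Span-generator A g a∈ (suc i) =
    let b , b∈ , eq = Span-generator A (tail g) a∈ i
    in 0# ∷ b , (λ { zero → Subring.0∈ A ; (suc i) → b∈ i }) ,
       trans (sym (+-identityˡ _)) (+-cong (sym (zeroˡ _)) eq)

  Span-elim : ∀ {A T : KPred} → Additive T → ∀ {n} {g : Vector Carrier n} →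
              (∀ {a} → a ∈ A → ∀ i → a * g i ∈ T) → Span A g ⊆ T
  Span-elim T f (a , a∈ , eq) =
    Additive.resp T (sym eq) (sum-closed T _ (λ i → f (a∈ i) i))

  infixl 7 _⊗_
  _⊗_ : ∀ {m n} → Vector Carrier m → Vector Carrier n → Vector Carrier (m ℕ.* n)
  _⊗_ {m} {n} g h k = let i , j = remQuot n k in g i * h j

  ⊗-combine : ∀ {m n} (g : Vector Carrier m) (h : Vector Carrier n) i j →
              (g ⊗ h) (combine i j) ≡ g i * h j
  ⊗-combine g h i j = ≡.cong (λ (i , j) → g i * h j) (remQuot-combine i j)

  Span-⊗ : (A : Subring K) → ∀ {m n} (g : Vector Carrier m) (h : Vector Carrier n) {x} →
           x ∈ Span (Subring.carrier A) g → ∀ j → x * h j ∈ Span (Subring.carrier A) (g ⊗ h)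
  Span-⊗ A g h x∈ j = Span-elim (multiples-additive S (h j))
    (λ {a} a∈ i → Additive.resp S
      (trans (*-congˡ (reflexive (⊗-combine g h i j))) (sym (*-assoc a (g i) (h j))))
      (Span-generator A (g ⊗ h) a∈ (combine i j)))
    x∈
    where S = Span-additive A (g ⊗ h)

  Span-* : (A : Subring K) → ∀ {n} {g : Vector Carrier n} {a x} → a ∈ Subring.carrier A →
           x ∈ Span (Subring.carrier A) g → a * x ∈ Span (Subring.carrier A) g
  Span-* A {g = g} {a} {x} a∈ x∈ = Additive.resp S (*-comm x a)
    (Span-elim (multiples-additive S a)
      (λ {b} b∈ i → Additive.resp S (lemma b i)
        (Span-generator A g (Subring.*-closed A a∈ b∈) i))
      x∈)
    where
    S = Span-additive A g
    lemma : ∀ b i → (a * b) * g i ≈ (b * g i) * a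
    lemma b i = trans (*-assoc a b (g i)) (*-comm a (b * g i))

  ×ℕ≈ : ∀ n x → n ×ℕ x ≈ (n ×ℕ 1#) * x
  ×ℕ≈ n x = sym (trans (×-assoc-* n 1# x) (×-congʳ n (*-identityˡ x)))

  infixl 7 _⊡_
  _⊡_ : ∀ {A} → FractionalIdeal A → FractionalIdeal A → FractionalIdeal A
  _⊡_ {A} I J = record
    { carrier  = I.carrier · J.carrier
    ; resp     = Additive.resp ·-additive
    ; 0∈       = Additive.0∈ ·-additive
    ; +-closed = Additive.+-closed ·-additive
    ; *-closed = λ {a} a∈ z∈ → Additive.resp ·-additive (*-comm _ a)
        (·-elim (multiples-additive ·-additive a)
          (λ x∈ y∈ → Additive.resp ·-additive
            (trans (*-assoc a _ _) (*-comm a _)) (·-intro (I.*-closed a∈ x∈) y∈))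
          z∈)
    ; finitelyGenerated =
        let m , g , g∈ , I⊆ = I.finitelyGenerated
            n , h , h∈ , J⊆ = J.finitelyGenerated
        in m ℕ.* n , g ⊗ h , (λ k → ·-intro (g∈ _) (h∈ _)) ,
           ·-elim (Span-additive A (g ⊗ h)) λ {x} {y} x∈ y∈ →
             Additive.resp (Span-additive A (g ⊗ h)) (*-comm y x)
               (Span-elim (multiples-additive (Span-additive A (g ⊗ h)) x)
                 (λ {a} a∈ j → Additive.resp (Span-additive A (g ⊗ h))
                   (trans (*-assoc a x (h j)) (trans (*-congˡ (*-comm x (h j)))
                     (sym (*-assoc a (h j) x))))
                   (Span-⊗ A g h (Span-* A a∈ (I⊆ x∈)) j))
                 (J⊆ y∈))
    ; spansℚ   = λ x →
        let m , m≢0 , m1∈ = I.spansℚ 1#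
            n , n≢0 , nx∈ = J.spansℚ x
        in m ℕ.* n , ℕₚ.m*n≢0 m n {{m≢0}} {{n≢0}} ,
           Additive.resp ·-additive (spans-lemma m n x) (·-intro m1∈ nx∈)
    }
    where
    module I = FractionalIdeal I
    module J = FractionalIdeal J
    spans-lemma : ∀ m n x → (m ×ℕ 1#) * (n ×ℕ x) ≈ (m ℕ.* n) ×ℕ x
    spans-lemma m n x = begin
      (m ×ℕ 1#) * (n ×ℕ x)          ≈⟨ *-congˡ (×ℕ≈ n x) ⟩
      (m ×ℕ 1#) * ((n ×ℕ 1#) * x)   ≈⟨ *-assoc _ _ _ ⟨
      (m ×ℕ 1#) * (n ×ℕ 1#) * x     ≈⟨ *-congʳ (×1-homo-* m n) ⟨
      ((m ℕ.* n) ×ℕ 1#) * x         ≈⟨ ×ℕ≈ (m ℕ.* n) x ⟨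
      (m ℕ.* n) ×ℕ x                ∎

  record Scaling (P Q : KPred) : Set (c ⊔ ℓ) where
    field
      α β  : Carrier
      αβ≈1 : α * β ≈ 1#
      to   : ∀ {x} → x ∈ P → α * x ∈ Q
      from : ∀ {y} → y ∈ Q → β * y ∈ P

    βαx≈x : ∀ x → β * (α * x) ≈ x
    βαx≈x x = trans (sym (*-assoc β α x))
      (trans (*-congʳ (trans (*-comm β α) αβ≈1)) (*-identityˡ x))

    αβx≈x : ∀ x → α * (β * x) ≈ x
    αβx≈x x = trans (sym (*-assoc α β x)) (trans (*-congʳ αβ≈1) (*-identityˡ x))

  ≐⇒Scaling : ∀ {A} (I J : FractionalIdeal A) →
              ∣ I ∣ ≐ ∣ J ∣ → Scaling ∣ I ∣ ∣ J ∣
  ≐⇒Scaling I J (I⊆J , J⊆I) = record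
    { α    = 1#
    ; β    = 1#
    ; αβ≈1 = *-identityˡ 1#
    ; to   = λ x∈ → FractionalIdeal.resp J (sym (*-identityˡ _)) (I⊆J x∈)
    ; from = λ x∈ → FractionalIdeal.resp I (sym (*-identityˡ _)) (J⊆I x∈)
    }

  Scaling-sym : ∀ {P Q} → Scaling P Q → Scaling Q P
  Scaling-sym s = record
    { α = β ; β = α ; αβ≈1 = trans (*-comm β α) αβ≈1 ; to = from ; from = to }
    where open Scaling s

  Scaling-trans : ∀ {A B} (I J : FractionalIdeal A) (L : FractionalIdeal B) →
    Scaling ∣ I ∣ ∣ J ∣ → Scaling ∣ J ∣ ∣ L ∣ → Scaling ∣ I ∣ ∣ L ∣
  Scaling-trans I J L s t = record
    { α    = t.α * s.α
    ; β    = t.β * s.β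
    ; αβ≈1 = trans (interchange t.α s.α t.β s.β)
               (trans (*-cong t.αβ≈1 s.αβ≈1) (*-identityˡ 1#))
    ; to   = λ x∈ → FractionalIdeal.resp L (sym (*-assoc _ _ _)) (t.to (s.to x∈))
    ; from = λ x∈ → FractionalIdeal.resp I
               (trans (sym (*-assoc _ _ _)) (*-congʳ (*-comm s.β t.β))) (s.from (t.from x∈))
    }
    where
    module s = Scaling s
    module t = Scaling t

  Scaling-· : ∀ {P P′ Q Q′} → Scaling P P′ → Scaling Q Q′ → Scaling (P · Q) (P′ · Q′)
  Scaling-· s t = record
    { α    = s.α * t.α
    ; β    = s.β * t.β
    ; αβ≈1 = trans (interchange s.α t.α s.β t.β)
               (trans (*-cong s.αβ≈1 t.αβ≈1) (*-identityˡ 1#))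
    ; to   = scale s.to t.to
    ; from = scale s.from t.from
    }
    where
    module s = Scaling s
    module t = Scaling t
    scale : ∀ {P P′ Q Q′ a b} → (∀ {x} → x ∈ P → a * x ∈ P′) → (∀ {y} → y ∈ Q → b * y ∈ Q′) →
            ∀ {z} → z ∈ P · Q → (a * b) * z ∈ P′ · Q′
    scale f g z∈ = Additive.resp ·-additive (*-comm _ _)
      (·-elim (multiples-additive ·-additive _)
        (λ x∈ y∈ → Additive.resp ·-additive
          (trans (interchange _ _ _ _) (*-comm _ _)) (·-intro (f x∈) (g y∈)))
        z∈)

  Scaling⇒≅ : ∀ {A} (I J : FractionalIdeal A) →
              Scaling ∣ I ∣ ∣ J ∣ → I ≅ J
  Scaling⇒≅ I J s = (λ (x , x∈) → α * x , to x∈) , record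
    { isLeftModuleMonomorphism = record
      { isLeftModuleHomomorphism = record
        { +ᴹ-isGroupHomomorphism = record
          { isMonoidHomomorphism = record
            { isMagmaHomomorphism = record
              { isRelHomomorphism = record { cong = *-congˡ }
              ; homo              = λ (x , _) (y , _) → distribˡ α x y
              }
            ; ε-homo = zeroʳ α
            }
          ; ⁻¹-homo = λ (x , _) → sym (-‿distribʳ-* α x)
          }
        ; *ₗ-homo = λ (a , _) (x , _) → x∙yz≈y∙xz α a x
        }
      ; injective = λ {(x , _)} {(y , _)} eq →
          trans (sym (βαx≈x x)) (trans (*-congˡ eq) (βαx≈x y))
      }
    ; surjective = λ (y , y∈) → (β * y , from y∈) , λ eq → trans (*-congˡ eq) (αβx≈x y)
    }
    where open Scaling s

  module _ (R : Order K) (A : Subring K) (R⊆A : Order.carrier R ⊆ Subring.carrier A) where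
    private
      module R = Order R
      module A = Subring A

      ×ℕ1∈ : (B : Subring K) → ∀ n → n ×ℕ 1# ∈ Subring.carrier B
      ×ℕ1∈ B ℕ.zero    = Subring.0∈ B
      ×ℕ1∈ B (ℕ.suc n) = Subring.+-closed B (Subring.1∈ B) (×ℕ1∈ B n)

      -- R is torsion-free over ℤ, so nonzero integers are regular in R.
      integer-regular : ∀ n → NonZero n → R.Regular (n ×ℕ 1#)
      integer-regular n n≢0 = ×ℕ1∈ R.subring n , λ {y} y∈ ny≈0 →
        let rank , e , e∈ , spans , independent = R.freeOfFiniteRank
            z , y≈ = spans y∈
            nz≡0 = independent (λ i → + n ℤ.* z i) (begin
              sum (λ i → _×ℤ_ K (+ n ℤ.* z i) (e i))  ≈⟨ sum-cong-≋ (λ i → scale n (z i) (e i)) ⟩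
              sum (λ i → (n ×ℕ 1#) * _×ℤ_ K (z i) (e i)) ≈⟨ sum-scale (n ×ℕ 1#) (λ i → _×ℤ_ K (z i) (e i)) ⟨
              (n ×ℕ 1#) * sum (λ i → _×ℤ_ K (z i) (e i)) ≈⟨ *-congˡ y≈ ⟨
              (n ×ℕ 1#) * y ≈⟨ ny≈0 ⟩
              0# ∎)
        in trans y≈ (trans (sum-cong-≋ (λ i → reflexive (≡.cong (λ k → _×ℤ_ K k (e i))
             (cancel n n≢0 (z i) (nz≡0 i))))) (sum-0 rank))
        where
        sum-0 : ∀ r → sum {r} (λ _ → 0#) ≈ 0#
        sum-0 ℕ.zero    = refl
        sum-0 (ℕ.suc r) = trans (+-identityˡ _) (sum-0 r)
        sum-scale : ∀ a {r} (v : Vector Carrier r) → a * sum v ≈ sum (λ i → a * v i)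
        sum-scale a {ℕ.zero}  v = zeroʳ a
        sum-scale a {ℕ.suc r} v = trans (distribˡ a _ _) (+-congˡ (sum-scale a (tail v)))
        ×ℕ-* : ∀ m k x → (m ℕ.* k) ×ℕ x ≈ (m ×ℕ 1#) * (k ×ℕ x)
        ×ℕ-* m k x = begin
          (m ℕ.* k) ×ℕ x               ≈⟨ ×ℕ≈ (m ℕ.* k) x ⟩
          ((m ℕ.* k) ×ℕ 1#) * x        ≈⟨ *-congʳ (×1-homo-* m k) ⟩
          (m ×ℕ 1#) * (k ×ℕ 1#) * x    ≈⟨ *-assoc _ _ _ ⟩
          (m ×ℕ 1#) * ((k ×ℕ 1#) * x)  ≈⟨ *-congˡ (×ℕ≈ k x) ⟨
          (m ×ℕ 1#) * (k ×ℕ x)         ∎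
        scale : ∀ m k x → _×ℤ_ K (+ m ℤ.* k) x ≈ (m ×ℕ 1#) * _×ℤ_ K k x
        scale m (+ k) x rewrite ≡.sym (ℤₚ.pos-* m k) = ×ℕ-* m k x
        scale ℕ.zero -[1+ k ] x = sym (zeroˡ _)
        scale (ℕ.suc m) -[1+ k ] x =
          trans (-‿cong (×ℕ-* (ℕ.suc m) (ℕ.suc k) x)) (-‿distribʳ-* _ _)
        cancel : ∀ m → NonZero m → ∀ k → + m ℤ.* k ≡ 0ℤ → k ≡ 0ℤ
        cancel (ℕ.suc m) _ k eq with ℤₚ.i*j≡0⇒i≡0∨j≡0 (+ ℕ.suc m) eq
        ... | inj₂ k≡0 = k≡0

      unit-cancel : ∀ {u v x y} → u * v ≈ 1# → u * x ≈ u * y → x ≈ y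
      unit-cancel {u} {v} {x} {y} uv≈1 eq = begin
        x            ≈⟨ v*u* x ⟨
        v * (u * x)  ≈⟨ *-congˡ eq ⟩
        v * (u * y)  ≈⟨ v*u* y ⟩
        y            ∎
        where
        v*u* : ∀ z → v * (u * z) ≈ z
        v*u* z = trans (sym (*-assoc v u z))
          (trans (*-congʳ (trans (*-comm v u) uv≈1)) (*-identityˡ z))

      module _ (I J : FractionalIdeal A) where
        private
          module I = FractionalIdeal I
          module J = FractionalIdeal J

        module Linear (f : ∃ I.carrier → ∃ J.carrier)
          (isHom : LeftModuleMorphisms.IsLeftModuleHomomorphism I.rawLeftModule J.rawLeftModule f)
          where
          open LeftModuleMorphisms.IsLeftModuleHomomorphism isHom

          private
            n    = proj₁ (I.spansℚ 1#)
            n≢0  = proj₁ (proj₂ (I.spansℚ 1#))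
            ν    = n ×ℕ 1#
            ν∈   = proj₂ (proj₂ (I.spansℚ 1#))
            ν∈A  = ×ℕ1∈ A n
            ν⁻¹  = proj₁ (proj₁ R.totalQuotientRing (integer-regular n n≢0))
            νν⁻¹ = proj₂ (proj₁ R.totalQuotientRing (integer-regular n n≢0))
            fν   = proj₁ (f (ν , ν∈))

          factor : Carrier
          factor = ν⁻¹ * fν

          f≈ : ∀ x (x∈ : x ∈ I.carrier) → proj₁ (f (x , x∈)) ≈ factor * x
          f≈ x x∈ =
            let b , b-reg , bx∈R = proj₂ R.totalQuotientRing x
                b⁻¹ , bb⁻¹ = proj₁ R.totalQuotientRing b-reg
                b∈A  = R⊆A (proj₁ b-reg)
                bx∈A = R⊆A bx∈R
                fx   = proj₁ (f (x , x∈))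
            in unit-cancel νν⁻¹ (unit-cancel bb⁻¹ (begin
                 b * (ν * fx)                    ≈⟨ *-assoc b ν fx ⟨
                 (b * ν) * fx                    ≈⟨ *ₗ-homo (b * ν , A.*-closed b∈A ν∈A) (x , x∈) ⟨
                 proj₁ (f (b * ν * x , I.*-closed (A.*-closed b∈A ν∈A) x∈))
                   ≈⟨ ⟦⟧-cong (trans (*-assoc b ν x) (trans (*-congˡ (*-comm ν x)) (sym (*-assoc b x ν)))) ⟩
                 proj₁ (f (b * x * ν , I.*-closed bx∈A ν∈))
                   ≈⟨ *ₗ-homo (b * x , bx∈A) (ν , ν∈) ⟩
                 (b * x) * fν                    ≈⟨ *-assoc b x fν ⟩
                 b * (x * fν)                    ≈⟨ *-congˡ (*-comm x fν) ⟩
                 b * (fν * x)                    ≈⟨ *-congˡ (*-congʳ (*-identityˡ fν)) ⟨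
                 b * ((1# * fν) * x)             ≈⟨ *-congˡ (*-congʳ (*-congʳ νν⁻¹)) ⟨
                 b * (((ν * ν⁻¹) * fν) * x)      ≈⟨ *-congˡ (*-congʳ (*-assoc ν ν⁻¹ fν)) ⟩
                 b * ((ν * (ν⁻¹ * fν)) * x)      ≈⟨ *-congˡ (*-assoc ν factor x) ⟩
                 b * (ν * (factor * x))          ∎))

    ≅⇒Scaling : (I J : FractionalIdeal A) → I ≅ J →
                Scaling ∣ I ∣ ∣ J ∣
    ≅⇒Scaling I J (f , isIso) = record
      { α    = α
      ; β    = β
      ; αβ≈1 = αβ≈1
      ; to   = λ {x} x∈ → J.resp (f≈ x x∈) (proj₂ (f (x , x∈)))
      ; from = λ {y} y∈ → I.resp (βy≈ y∈) (proj₂ (proj₁ (surjective (y , y∈))))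
      }
      where
      module I = FractionalIdeal I
      module J = FractionalIdeal J
      open LeftModuleMorphisms.IsLeftModuleIsomorphism isIso
      open Linear I J f isLeftModuleHomomorphism renaming (factor to α)

      n≢0  = proj₁ (proj₂ (J.spansℚ 1#))
      ν    = proj₁ (J.spansℚ 1#) ×ℕ 1#
      ν∈   = proj₂ (proj₂ (J.spansℚ 1#))
      ν⁻¹  = proj₁ (proj₁ R.totalQuotientRing (integer-regular _ n≢0))
      νν⁻¹ = proj₂ (proj₁ R.totalQuotientRing (integer-regular _ n≢0))

      g : ∀ {y} → y ∈ J.carrier → Carrier
      g {y} y∈ = proj₁ (proj₁ (surjective (y , y∈)))

      αg≈ : ∀ {y} (y∈ : y ∈ J.carrier) → α * g y∈ ≈ y
      αg≈ {y} y∈ = trans (sym (f≈ _ (proj₂ (proj₁ (surjective (y , y∈))))))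
                     (proj₂ (surjective (y , y∈)) refl)

      β = ν⁻¹ * g ν∈

      αβ≈1 : α * β ≈ 1#
      αβ≈1 = trans (x∙yz≈y∙xz α ν⁻¹ _) (trans (*-congˡ (αg≈ ν∈)) (trans (*-comm ν⁻¹ ν) νν⁻¹))

      βy≈ : ∀ {y} (y∈ : y ∈ J.carrier) → g y∈ ≈ β * y
      βy≈ {y} y∈ = unit-cancel αβ≈1
        (trans (αg≈ y∈) (sym (trans (sym (*-assoc α β y))
          (trans (*-congʳ αβ≈1) (*-identityˡ y)))))

  module _ {R : Order K} (S : OverOrder R) where
    private
      module R = Order R
      module S = OverOrder S

    unitIdeal : FractionalIdeal S.subring
    unitIdeal = record
      { carrier  = S.carrier
      ; resp     = S.resp
      ; 0∈       = S.0∈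
      ; +-closed = S.+-closed
      ; *-closed = S.*-closed
      ; finitelyGenerated = 1 , (λ _ → 1#) , (λ _ → S.1∈) ,
          λ {x} x∈ → (λ _ → x) , (λ _ → x∈) ,
            sym (trans (+-identityʳ _) (*-identityʳ x))
      ; spansℚ   = S.spansℚ
      }

    restrict : FractionalIdeal S.subring → FractionalIdeal R.subring
    restrict I = record
      { carrier  = I.carrier
      ; resp     = I.resp
      ; 0∈       = I.0∈
      ; +-closed = I.+-closed
      ; *-closed = I.*-closed ∘ S.R⊆
      ; finitelyGenerated =
          let m , g , g∈ , S⊆ = S.finitelyGenerated
              n , h , h∈ , I⊆ = I.finitelyGenerated
          in m ℕ.* n , g ⊗ h , (λ k → I.*-closed (g∈ _) (h∈ _)) , λ x∈ →
             Span-elim (Span-additive R.subring (g ⊗ h))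
               (λ s∈ j → Span-⊗ R.subring g h (S⊆ s∈) j) (I⊆ x∈)
      ; spansℚ   = I.spansℚ
      }
      where module I = FractionalIdeal I

    private
      module _ {P : KPred} (P-additive : Additive P)
               (P-module : ∀ {s x} → s ∈ S.carrier → x ∈ P → s * x ∈ P) where
        S·P⊆P : S.carrier · P ⊆ P
        S·P⊆P = ·-elim P-additive P-module

        P⊆S·P : P ⊆ S.carrier · P
        P⊆S·P x∈ = Additive.resp ·-additive (*-identityˡ _) (·-intro S.1∈ x∈)

      toScalingˢ : (I J : FractionalIdeal S.subring) → I ≅ J → _
      toScalingˢ = ≅⇒Scaling R S.subring S.R⊆

      toScalingᴿ : (I J : FractionalIdeal R.subring) → I ≅ J → _
      toScalingᴿ = ≅⇒Scaling R R.subring id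

      ≐⇒≅ : ∀ {A} (I J : FractionalIdeal A) →
            ∣ I ∣ ≐ ∣ J ∣ → I ≅ J
      ≐⇒≅ I J eq = Scaling⇒≅ I J (≐⇒Scaling I J eq)

      ≅ˢ-sym : (I J : FractionalIdeal S.subring) → I ≅ J → J ≅ I
      ≅ˢ-sym I J p = Scaling⇒≅ J I (Scaling-sym (toScalingˢ I J p))

      ≅ˢ-trans : (I J L : FractionalIdeal S.subring) → I ≅ J → J ≅ L → I ≅ L
      ≅ˢ-trans I J L p q =
        Scaling⇒≅ I L (Scaling-trans I J L (toScalingˢ I J p) (toScalingˢ J L q))

      ≅ᴿ-sym : (I J : FractionalIdeal R.subring) → I ≅ J → J ≅ I
      ≅ᴿ-sym I J p = Scaling⇒≅ J I (Scaling-sym (toScalingᴿ I J p))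

      ≅ᴿ-trans : (I J L : FractionalIdeal R.subring) → I ≅ J → J ≅ L → I ≅ L
      ≅ᴿ-trans I J L p q =
        Scaling⇒≅ I L (Scaling-trans I J L (toScalingᴿ I J p) (toScalingᴿ J L q))

      unit : InvertibleIdeal S.subring
      unit = record
        { ideal     = unitIdeal
        ; inverse   = unitIdeal
        ; isInverse = S·P⊆P S-additive S.*-closed , P⊆S·P S-additive S.*-closed
        }
        where S-additive = subring-additive S.subring

      product : (I J : InvertibleIdeal S.subring) → InvertibleIdeal S.subring
      product I J = record
        { ideal     = I.ideal ⊡ J.ideal
        ; inverse   = I.inverse ⊡ J.inverse
        ; isInverse =
            (S·P⊆P S-additive S.*-closed ∘ ·-mono (proj₁ I.isInverse) (proj₁ J.isInverse) ∘
              exchange) ,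
            (exchange ∘ ·-mono (proj₂ I.isInverse) (proj₂ J.isInverse) ∘
              P⊆S·P S-additive S.*-closed)
        }
        where
        module I = InvertibleIdeal I
        module J = InvertibleIdeal J
        S-additive = subring-additive S.subring
        exchange : ∀ {A B C D} → (A · B) · (C · D) ⊆ (A · C) · (B · D)
        exchange = ·-assocˡ ∘ ·-mono id (·-assocʳ ∘ ·-mono ·-comm id ∘ ·-assocˡ) ∘ ·-assocʳ

      invert : InvertibleIdeal S.subring → InvertibleIdeal S.subring
      invert I = record
        { ideal     = I.inverse
        ; inverse   = I.ideal
        ; isInverse = proj₁ I.isInverse ∘ ·-comm , ·-comm ∘ proj₂ I.isInverse
        }
        where module I = InvertibleIdeal I

      invert-Scaling : (I J : InvertibleIdeal S.subring) →
        Scaling ∣ InvertibleIdeal.ideal I ∣ ∣ InvertibleIdeal.ideal J ∣ →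
        Scaling ∣ InvertibleIdeal.inverse I ∣ ∣ InvertibleIdeal.inverse J ∣
      invert-Scaling I J s = record
        { α    = β
        ; β    = α
        ; αβ≈1 = trans (*-comm β α) αβ≈1
        ; to   = scale I J from
        ; from = scale J I to
        }
        where
        open Scaling s
        scale : (I J : InvertibleIdeal S.subring) →
          ∀ {b} → (∀ {y} → y ∈ ∣ InvertibleIdeal.ideal J ∣ → b * y ∈ ∣ InvertibleIdeal.ideal I ∣) →
          ∀ {x} → x ∈ ∣ InvertibleIdeal.inverse I ∣ → b * x ∈ ∣ InvertibleIdeal.inverse J ∣
        scale I J {b} f {x} x∈ = J⁻¹.resp (*-identityˡ _)
          (·-elim (multiples-additive (ideal-additive J.inverse) (b * x))
            (λ {y} {z} y∈ z∈ → J⁻¹.resp (lemma y z)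
              (J⁻¹.*-closed (proj₁ I.isInverse (·-intro (f y∈) x∈)) z∈))
            (proj₂ J.isInverse S.1∈))
          where
          module I = InvertibleIdeal I
          module J = InvertibleIdeal J
          module J⁻¹ = FractionalIdeal J.inverse
          lemma : ∀ y z → ((b * y) * x) * z ≈ (y * z) * (b * x)
          lemma y z = begin
            ((b * y) * x) * z  ≈⟨ *-assoc _ _ _ ⟩
            (b * y) * (x * z)  ≈⟨ *-cong (*-comm b y) (*-comm x z) ⟩
            (y * b) * (z * x)  ≈⟨ interchange y b z x ⟩
            (y * z) * (b * x)  ∎

    -- Classes are represented by their members; being isomorphic (or weakly
    -- equivalent) is the equality of the group or setoid.
    Pic : Group (Level.suc (c ⊔ ℓ)) (c ⊔ ℓ)
    Pic = record
      { Carrier = InvertibleIdeal S.subring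
      ; _≈_     = λ I J → InvertibleIdeal.ideal I ≅ InvertibleIdeal.ideal J
      ; _∙_     = product
      ; ε       = unit
      ; _⁻¹     = invert
      ; isGroup = record
        { isMonoid = record
          { isSemigroup = record
            { isMagma = record
              { isEquivalence = record
                { refl  = λ {I} → ≐⇒≅ (id′ I) (id′ I) (id , id)
                ; sym   = λ {I} {J} → ≅ˢ-sym (id′ I) (id′ J)
                ; trans = λ {I} {J} {L} → ≅ˢ-trans (id′ I) (id′ J) (id′ L)
                }
              ; ∙-cong = λ {I} {I′} {J} {J′} p q →
                  Scaling⇒≅ (id′ (product I J)) (id′ (product I′ J′))
                    (Scaling-· (toScalingˢ (id′ I) (id′ I′) p) (toScalingˢ (id′ J) (id′ J′) q))
              }
            ; assoc = λ I J L → ≐⇒≅ (id′ (product (product I J) L)) (id′ (product I (product J L)))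
                (·-assocʳ , ·-assocˡ)
            }
          ; identity =
              (λ I → ≐⇒≅ (id′ (product unit I)) (id′ I) (S·I≐I I)) ,
              (λ I → ≐⇒≅ (id′ (product I unit)) (id′ I)
                (proj₁ (S·I≐I I) ∘ ·-comm , ·-comm ∘ proj₂ (S·I≐I I)))
          }
        ; inverse =
            (λ I → ≐⇒≅ (id′ (product (invert I) I)) unitIdeal
              (InvertibleIdeal.isInverse (invert I))) ,
            (λ I → ≐⇒≅ (id′ (product I (invert I))) unitIdeal
              (InvertibleIdeal.isInverse I))
        ; ⁻¹-cong = λ {I} {J} p → Scaling⇒≅ (id′ (invert I)) (id′ (invert J))
            (invert-Scaling I J (toScalingˢ (id′ I) (id′ J) p))
        }
      }
      where
      id′ = InvertibleIdeal.ideal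
      S·I≐I : (I : InvertibleIdeal S.subring) →
              S.carrier · ∣ id′ I ∣ ≐ ∣ id′ I ∣
      S·I≐I I = S·P⊆P I-additive I.*-closed , P⊆S·P I-additive I.*-closed
        where
        module I = InvertibleIdeal I
        I-additive = ideal-additive I.ideal

    record IdealWithRing : Set (Level.suc (c ⊔ ℓ)) where
      field
        ideal    : FractionalIdeal R.subring
        hasRing  : multiplicatorRing ideal ≐ S.carrier
      open FractionalIdeal ideal public

    ICM : Setoid (Level.suc (c ⊔ ℓ)) (c ⊔ ℓ)
    ICM = record
      { Carrier = IdealWithRing
      ; _≈_     = λ I J → id′ I ≅ id′ J
      ; isEquivalence = record
        { refl  = λ {I} → ≐⇒≅ (id′ I) (id′ I) (id , id)
        ; sym   = λ {I} {J} → ≅ᴿ-sym (id′ I) (id′ J)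
        ; trans = λ {I} {J} {L} → ≅ᴿ-trans (id′ I) (id′ J) (id′ L)
        }
      }
      where id′ = IdealWithRing.ideal

    𝓦 : Setoid (Level.suc (c ⊔ ℓ)) (c ⊔ ℓ)
    𝓦 = record
      { Carrier = IdealWithRing
      ; _≈_     = λ I J → IdealWithRing.ideal I ~ IdealWithRing.ideal J
      ; isEquivalence = record
        { refl  = λ {I} → ~-refl I
        ; sym   = ·-comm
        ; trans = λ {I} {J} {L} → ~-trans I J L
        }
      }
      where
      id′ = IdealWithRing.ideal

      ~-refl : ∀ I → id′ I ~ id′ I
      ~-refl I = Additive.resp ·-additive (*-identityˡ 1#) (·-intro 1∈I∶I 1∈I∶I)
        where
        open IdealWithRing I
        1∈I∶I : 1# ∈ carrier ∶ carrier
        1∈I∶I = λ _ x∈ → resp (sym (*-identityˡ _)) x∈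

      ∶-compose : ∀ {A B} (P : FractionalIdeal A) {Q : KPred} (T : FractionalIdeal B) {x y} →
        x ∈ ∣ P ∣ ∶ Q → y ∈ Q ∶ ∣ T ∣ → x * y ∈ ∣ P ∣ ∶ ∣ T ∣
      ∶-compose P T x∈ y∈ _ z∈ =
        FractionalIdeal.resp P (sym (*-assoc _ _ _)) (x∈ _ (y∈ _ z∈))

      ~-trans : ∀ I J L → id′ I ~ id′ J → id′ J ~ id′ L → id′ I ~ id′ L
      ~-trans I J L p q = Additive.resp ·-additive (*-identityˡ 1#)
        (·-elim (multiples-additive ·-additive 1#)
          (λ {a} {b} a∈ b∈ → Additive.resp ·-additive (*-comm 1# (a * b))
            (·-elim (multiples-additive ·-additive (a * b))
              (λ {d} {e} d∈ e∈ → Additive.resp ·-additive (lemma a b d e)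
                (·-intro (∶-compose (id′ I) (id′ L) a∈ d∈) (∶-compose (id′ L) (id′ I) e∈ b∈)))
              q))
          p)
        where
        lemma : ∀ a b d e → (a * d) * (e * b) ≈ (d * e) * (a * b)
        lemma a b d e = begin
          (a * d) * (e * b)  ≈⟨ *-congʳ (*-comm a d) ⟩
          (d * a) * (e * b)  ≈⟨ interchange d a e b ⟩
          (d * e) * (a * b)  ∎

    private
      act : InvertibleIdeal S.subring → IdealWithRing → IdealWithRing
      act L I = record
        { ideal   = restrict L.ideal ⊡ I.ideal
        ; hasRing = shrink , grow
        }
        where
        module L = InvertibleIdeal L
        module L⁻¹ = FractionalIdeal L.inverse
        module I = IdealWithRing I

        L·I∋ : ∀ {z w} → z ∈ L.carrier · I.carrier → w ∈ L⁻¹.carrier → w * z ∈ I.carrier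
        L·I∋ {z} {w} z∈ w∈ = I.resp (*-comm z w)
          (·-elim (multiples-additive (ideal-additive I.ideal) w)
            (λ {x} {y} x∈ y∈ → I.resp (lemma x y)
              (proj₂ I.hasRing (proj₁ L.isInverse (·-intro x∈ w∈)) y y∈))
            z∈)
          where
          lemma : ∀ x y → (x * w) * y ≈ (x * y) * w
          lemma x y = trans (*-assoc x w y) (trans (*-congˡ (*-comm w y)) (sym (*-assoc x y w)))

        shrink : (L.carrier · I.carrier) ∶ (L.carrier · I.carrier) ⊆ S.carrier
        shrink {x} x∈ = proj₁ I.hasRing λ i i∈ → I.resp (*-identityˡ (x * i))
          (·-elim (multiples-additive (ideal-additive I.ideal) (x * i))
            (λ {l} {m} l∈ m∈ → I.resp (lemma x i l m) (L·I∋ (x∈ _ (·-intro l∈ i∈)) m∈))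
            (proj₂ L.isInverse S.1∈))
          where
          lemma : ∀ x i l m → m * (x * (l * i)) ≈ (l * m) * (x * i)
          lemma x i l m = begin
            m * (x * (l * i))  ≈⟨ *-congˡ (x∙yz≈y∙xz x l i) ⟩
            m * (l * (x * i))  ≈⟨ *-assoc m l (x * i) ⟨
            (m * l) * (x * i)  ≈⟨ *-congʳ (*-comm m l) ⟩
            (l * m) * (x * i)  ∎

        grow : S.carrier ⊆ (L.carrier · I.carrier) ∶ (L.carrier · I.carrier)
        grow {s} s∈ z z∈ = Additive.resp ·-additive (*-comm z s)
          (·-elim (multiples-additive ·-additive s)
            (λ {x} {y} x∈ y∈ → Additive.resp ·-additive
              (trans (*-assoc s x y) (*-comm s (x * y))) (·-intro (L.*-closed s∈ x∈) y∈))
            z∈)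

    -- L ▷ I is the product L I.
    picAction : GroupAction Pic ICM
    picAction = record
      { _▷_      = act
      ; ▷-cong   = λ {L} {L′} {I} {I′} p q → Scaling⇒≅ (id′ (act L I)) (id′ (act L′ I′))
          (Scaling-· (toScalingˢ (InvertibleIdeal.ideal L) (InvertibleIdeal.ideal L′) p)
                     (toScalingᴿ (id′ I) (id′ I′) q))
      ; identity = λ I → ≐⇒≅ (id′ (act unit I)) (id′ I)
          (S·P⊆P (ideal-additive (id′ I)) (λ s∈ → proj₂ (IdealWithRing.hasRing I) s∈ _) ,
           P⊆S·P (ideal-additive (id′ I)) (λ s∈ → proj₂ (IdealWithRing.hasRing I) s∈ _))
      ; compat   = λ L L′ I → ≐⇒≅ (id′ (act (product L L′) I)) (id′ (act L (act L′ I)))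
          (·-assocʳ , ·-assocˡ)
      }
      where id′ = IdealWithRing.ideal

{-# OPTIONS --safe #-}

-- For I, I′ with multiplicator ring S, a witness 1 = Σ aᵢ bᵢ of 1 ∈ (I : I′)(I′ : I) makes
-- (I′ : I) an S-ideal generated by the bᵢ, with inverse (I : I′) and (I′ : I) I = I′.
-- Conversely, α L I = I′ forces α L ⊆ (I′ : I) and α⁻¹ L⁻¹ ⊆ (I : I′), and 1 ∈ L L⁻¹.
-- For I′ = I both colons are S, so α L = S: the action is free.
module Submission where

open import Defs hiding (_·_; _∶_; Scaling; module Scaling; Additive; module Additive)
import Defs
open import Algebra.Bundles using (CommutativeRing; Group)
import Algebra.Definitions.RawMonoid as RawMonoidDefinitions
import Algebra.Properties.CommutativeSemigroup as CommutativeSemigroupProperties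
import Algebra.Properties.Monoid.Mult as MultProperties
import Algebra.Properties.Semiring.Mult as SemiringMultProperties
import Algebra.Properties.Semiring.Sum as SemiringSumProperties
open import Data.Fin.Base using (Fin; zero; suc)
open import Data.Fin.Properties using (_≟_)
open import Data.Nat.Base as ℕ using (NonZero)
import Data.Nat.Properties as ℕₚ
open import Data.Product.Base using (∃; _×_; _,_; proj₁; proj₂)
open import Data.Vec.Functional using (Vector; tail)
open import Function.Base using (_∘_; id)
open import Function.Bundles using (_⇔_; mk⇔)
open import Level using (Level; _⊔_)
open import Relation.Binary.Bundles using (Setoid)
open import Relation.Binary.Definitions using (DecidableEquality)
open import Relation.Binary.PropositionalEquality.Core as ≡ using (_≢_)
open import Relation.Nullary.Decidable.Core using (yes; no)
open import Relation.Nullary.Negation.Core using (¬_)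
open import Relation.Unary using (_∈_; _⊆_)

-- Free group actions and orbit representatives.

module _ {g ℓg x ℓx : Level} {G : Group g ℓg} {X : Setoid x ℓx} (A : GroupAction G X) where
  private
    module G = Group G
    module X = Setoid X
  open GroupAction A

  ⁻¹▷-cancel : ∀ g x → ((g G.⁻¹) ▷ g ▷ x) X.≈ x
  ⁻¹▷-cancel g x = X.trans (X.sym (compat _ _ x))
    (X.trans (▷-cong (G.inverseˡ g) X.refl) (identity x))

  -- `h⁻¹ g` fixes `x`, hence is trivial, and `g = h (h⁻¹ g)`.
  free⇒▷-cancelʳ : Free → ∀ {g h x} → (g ▷ x) X.≈ (h ▷ x) → g G.≈ h
  free⇒▷-cancelʳ free {g} {h} {x} eq = G.trans (G.sym (G.identityˡ g))
    (G.trans (G.∙-congʳ (G.sym (G.inverseʳ h)))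
    (G.trans (G.assoc h _ g)
    (G.trans (G.∙-congˡ (free _ x (X.trans (compat _ _ x)
      (X.trans (▷-cong G.refl eq) (⁻¹▷-cancel h x)))))
    (G.identityʳ h))))

  ▷≈▷⇒sameOrbit : ∀ {g h x y} → (g ▷ x) X.≈ (h ▷ y) → SameOrbit x y
  ▷≈▷⇒sameOrbit {g} {h} {x} {y} eq = (h G.⁻¹) G.∙ g ,
    X.trans (compat _ _ x) (X.trans (▷-cong G.refl eq) (⁻¹▷-cancel h y))

  enumerates-▷ : Free → ∀ {i j} {I : Set i} {J : Set j} → DecidableEquality I →
    {x : I → X.Carrier} {g : J → G.Carrier} →
    (∀ y → ∃ λ i → SameOrbit (x i) y) →
    (∀ {i i′} → i ≢ i′ → ¬ SameOrbit (x i) (x i′)) →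
    Enumerates G.setoid g →
    Enumerates X {I × J} (λ (i , j) → g j ▷ x i)
  enumerates-▷ free _≟ᴵ_ {x} {g} x-complete x-distinct g-enumerates = record
    { complete = λ y →
        let i , h , hx≈y = x-complete y
            j , gj≈h     = complete h
        in (i , j) , X.trans (▷-cong gj≈h X.refl) hx≈y
    ; distinct = distinct′
    }
    where
    open Enumerates g-enumerates
    distinct′ : ∀ {p q} → p ≢ q → ¬ (g (proj₂ p) ▷ x (proj₁ p)) X.≈ (g (proj₂ q) ▷ x (proj₁ q))
    -- Constructively, `p ≢ q` does not tell which component differs, so the indices of the orbits
    -- are compared first. Within one orbit, freeness cancels the common point.
    distinct′ {i , j} {i′ , j′} p≢q eq with i ≟ᴵ i′
    ... | no  i≢i′   = x-distinct i≢i′ (▷≈▷⇒sameOrbit eq)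
    ... | yes ≡.refl = distinct (p≢q ∘ ≡.cong (i ,_)) (free⇒▷-cancelʳ free eq)

module _ {c ℓ : Level} {K : CommutativeRing c ℓ} where
  open CommutativeRing K hiding (zero)
  open RawMonoidDefinitions +-rawMonoid using () renaming (_×_ to _×ℕ_)
  open CommutativeSemigroupProperties *-commutativeSemigroup
    using (interchange; x∙yz≈yx∙z)
  open MultProperties +-monoid using (×-assocˡ; ×-congˡ)
  open SemiringMultProperties semiring using (×-assoc-*)
  open SemiringSumProperties semiring using (sum-cong-≋; *-distribˡ-sum)

  -- K is not inferable from a predicate on its carrier, so it is fixed here.
  private
    infixl 7 _·_
    infix  6 _∶_

    _·_ _∶_ : KPred {K = K} → KPred {K = K} → KPred {K = K}
    _·_ = Defs._·_ {K = K}
    _∶_ = Defs._∶_ {K = K}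

    Additive : KPred {K = K} → Set (c ⊔ ℓ)
    Additive = Defs.Additive {K = K}
    module Additive {T} = Defs.Additive {K = K} {T = T}

    Scaling : KPred {K = K} → KPred {K = K} → Set (c ⊔ ℓ)
    Scaling = Defs.Scaling {K = K}
    module Scaling {P Q} = Defs.Scaling {K = K} {P = P} {Q = Q}

  -- Denominators, additive subsets and colons.

  ×ℕ-closed : ∀ {T} → Additive T → ∀ n {x} → x ∈ T → n ×ℕ x ∈ T
  ×ℕ-closed T ℕ.zero    x∈ = Additive.0∈ T
  ×ℕ-closed T (ℕ.suc n) x∈ = Additive.+-closed T x∈ (×ℕ-closed T n x∈)

  -- The product of a denominator of the head and one of the tail serves for both.
  common-denominator : ∀ {T} → Additive T →
    (∀ x → ∃ λ n → NonZero n × n ×ℕ x ∈ T) →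
    ∀ {k} (v : Vector Carrier k) → ∃ λ n → NonZero n × (∀ i → n ×ℕ v i ∈ T)
  common-denominator T clear {ℕ.zero}  v = 1 , _ , λ ()
  common-denominator {T} T-additive clear {ℕ.suc k} v =
    let m , m≢0 , mv₀∈ = clear (v zero)
        n , n≢0 , nv∈  = common-denominator T-additive clear (tail v)
    in m ℕ.* n , ℕₚ.m*n≢0 m n {{m≢0}} {{n≢0}} , λ
         { zero    → resp (trans (×-assocˡ (v zero) n m) (×-congˡ (ℕₚ.*-comm n m)))
                       (×ℕ-closed T-additive n mv₀∈)
         ; (suc i) → resp (×-assocˡ (v (suc i)) m n) (×ℕ-closed T-additive m (nv∈ i))
         }
    where open Additive T-additive

  ∶-additive : ∀ {P Q} → Additive P → Additive (P ∶ Q)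
  ∶-additive P = record
    { resp     = λ x≈x′ x∈ y y∈ → resp (*-congʳ x≈x′) (x∈ y y∈)
    ; 0∈       = λ y _ → resp (sym (zeroˡ y)) 0∈
    ; +-closed = λ x∈ x′∈ y y∈ → resp (sym (distribʳ y _ _)) (+-closed (x∈ y y∈) (x′∈ y y∈))
    }
    where open Additive P

  -- At `T = P` this puts a product of opposite colons into the multiplicator ring `P ∶ P`.
  ∶·∶⊆∶ : ∀ {P Q T} → Additive P → (P ∶ Q) · (Q ∶ T) ⊆ P ∶ T
  ∶·∶⊆∶ P = ·-elim (∶-additive P) λ x∈ y∈ z z∈ →
    Additive.resp P (sym (*-assoc _ _ _)) (x∈ _ (y∈ z z∈))

  ∶·⊆ : ∀ {P Q} → Additive P → (P ∶ Q) · Q ⊆ P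
  ∶·⊆ P = ·-elim P λ x∈ y∈ → x∈ _ y∈

  -- Multiplying by the expansion 1 = Σ p q moves a factor q onto x.
  1∈·⇒∈· : ∀ {P Q T} {x} → 1# ∈ P · Q →
           (∀ {q} → q ∈ Q → q * x ∈ T) → x ∈ P · T
  1∈·⇒∈· {x = x} 1∈ qx∈ = Additive.resp ·-additive (*-identityˡ x)
    (·-elim (multiples-additive ·-additive x)
      (λ p∈ q∈ → Additive.resp ·-additive (sym (*-assoc _ _ _)) (·-intro p∈ (qx∈ q∈)))
      1∈)

  -- Ideals in one orbit, and freeness.

  module _ {R : Order K} (S : OverOrder R) where
    private
      module R = Order R
      module S = OverOrder S
    open GroupAction (picAction S)

    module _ (I : IdealWithRing S) where
      open IdealWithRing I

      S·I⊆I : S.carrier · carrier ⊆ carrier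
      S·I⊆I = ·-elim (ideal-additive ideal) λ s∈ x∈ → proj₂ hasRing s∈ _ x∈

    module _ (L : InvertibleIdeal S.subring) where
      open InvertibleIdeal L

      -- Reassociating, `L⁻¹ (L I) = (L⁻¹ L) I = S I`.
      inverse·▷⊆ : ∀ I → ∣ inverse ∣ · ∣ IdealWithRing.ideal (L ▷ I) ∣ ⊆ IdealWithRing.carrier I
      inverse·▷⊆ I = S·I⊆I I ∘ ·-mono (proj₁ isInverse ∘ ·-comm) id ∘ ·-assocˡ

    module _ (L : InvertibleIdeal S.subring) (I I′ : IdealWithRing S) where
      private
        module L = InvertibleIdeal L
        module I = IdealWithRing I
        module I′ = IdealWithRing I′

      module _ (s : Scaling (L.carrier · I.carrier) I′.carrier) where
        open Scaling s

        αL⊆I′∶I : ∀ {l} → l ∈ L.carrier → α * l ∈ I′.carrier ∶ I.carrier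
        αL⊆I′∶I l∈ i i∈ = I′.resp (sym (*-assoc _ _ i)) (to (·-intro l∈ i∈))

        -- `β` takes `I′` into `L I`, which `L⁻¹` carries back into `I`.
        βL⁻¹⊆I∶I′ : ∀ {m} → m ∈ ∣ L.inverse ∣ → β * m ∈ I.carrier ∶ I′.carrier
        βL⁻¹⊆I∶I′ m∈ i i∈ = I.resp (x∙yz≈yx∙z _ _ i)
          (inverse·▷⊆ L I (·-intro m∈ (from i∈)))

      -- In each term of `1 = Σ l m` from `L L⁻¹`, the factor `l m` equals `(β m) (α l)` because
      -- `αβ≈1`, so the same sum lies in the product of the two colons.
      sameOrbit⇒~ : Setoid._≈_ (ICM S) (L ▷ I) I′ → I.ideal ~ I′.ideal
      sameOrbit⇒~ iso = ·-elim ·-additive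
        (λ {l} {m} l∈ m∈ → Additive.resp ·-additive (lemma l m)
          (·-intro (βL⁻¹⊆I∶I′ s m∈) (αL⊆I′∶I s l∈)))
        (proj₂ L.isInverse S.1∈)
        where
        s = ≅⇒Scaling R R.subring id (IdealWithRing.ideal (L ▷ I)) I′.ideal iso
        open Scaling s
        lemma : ∀ l m → (β * m) * (α * l) ≈ l * m
        lemma l m = trans (interchange β m α l)
          (trans (*-cong (trans (*-comm β α) αβ≈1) (*-comm m l)) (*-identityˡ _))

    picAction-free : Free
    picAction-free L I iso = Scaling⇒≅ L.ideal (unitIdeal S) record
      { α    = α
      ; β    = β
      ; αβ≈1 = αβ≈1
      ; to   = λ l∈ → proj₁ I.hasRing (αL⊆I′∶I L I I scaling l∈)
      -- Write `1 = Σ l m` in `L L⁻¹`. Then `β s = Σ l (β m s)`, and each `β m` lies in `I ∶ I = S`,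
      -- so `β s` lies in `L S = L`.
      ; from = λ {s} s∈ → ·-elim (ideal-additive L.ideal)
          (λ l∈ t∈ → L.resp (*-comm _ _) (L.*-closed t∈ l∈))
          (1∈·⇒∈· {T = S.carrier} (proj₂ L.isInverse S.1∈) λ {m} m∈ →
            S.resp (sym (x∙yz≈yx∙z m β s))
              (S.*-closed (proj₁ I.hasRing (βL⁻¹⊆I∶I′ L I I scaling m∈)) s∈))
      }
      where
      module L = InvertibleIdeal L
      module I = IdealWithRing I
      scaling = ≅⇒Scaling R R.subring id (IdealWithRing.ideal (L ▷ I)) I.ideal iso
      open Scaling scaling

    -- The colon of weakly equivalent ideals.

    module _ (I J : IdealWithRing S) (I~J : IdealWithRing.ideal I ~ IdealWithRing.ideal J) where
      private
        module I = IdealWithRing I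
        module J = IdealWithRing J

      -- Applied below in both orders of `I` and `J`, since the opposite colon is the inverse.
      colonIdeal : FractionalIdeal S.subring
      colonIdeal = record
        { carrier  = J.carrier ∶ I.carrier
        ; resp     = resp
        ; 0∈       = 0∈
        ; +-closed = +-closed
        ; *-closed = λ s∈ x∈ y y∈ → J.resp (sym (*-assoc _ _ y)) (proj₂ J.hasRing s∈ _ (x∈ y y∈))
        -- From `1 = Σ a b` follows `x = Σ (x a) b`, and each coefficient `x a` lies in
        -- `(J ∶ I)(I ∶ J)`, hence in `J ∶ J = S`.
        ; finitelyGenerated =
            let finiteSum a b a∈ b∈ 1≈ = I~J
            in _ , b , b∈ , λ {x} x∈ →
                 (λ i → x * a i) ,
                 (λ i → proj₁ J.hasRing (∶·∶⊆∶ J-additive (·-intro x∈ (a∈ i)))) ,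
                 trans (sym (*-identityʳ x)) (trans (*-congˡ 1≈)
                   (trans (*-distribˡ-sum x (λ i → a i * b i))
                     (sum-cong-≋ (λ i → sym (*-assoc x (a i) (b i))))))
        -- One `n` with every `n x g` in `J`, for `g` among the finitely many generators of `I`,
        -- gives `n x I ⊆ J`.
        ; spansℚ   = λ x →
            let _ , g , _ , I⊆ = I.finitelyGenerated
                n , n≢0 , nxg∈  = common-denominator J-additive J.spansℚ (λ i → x * g i)
            in n , n≢0 , λ y y∈ → J.resp (*-comm y _)
                 (Span-elim (multiples-additive J-additive (n ×ℕ x))
                   (λ {r} r∈ i → J.resp
                     (trans (*-congˡ (trans (sym (×-assoc-* n x (g i))) (*-comm _ (g i))))
                       (sym (*-assoc r (g i) _)))
                     (J.*-closed r∈ (nxg∈ i)))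
                   (I⊆ y∈))
        }
        where
        J-additive = ideal-additive J.ideal
        open Additive (∶-additive {P = J.carrier} {Q = I.carrier} J-additive)

    module _ (I J : IdealWithRing S) (I~J : IdealWithRing.ideal I ~ IdealWithRing.ideal J) where
      private
        module I = IdealWithRing I
        module J = IdealWithRing J

      colonInvertible : InvertibleIdeal S.subring
      colonInvertible = record
        { ideal     = colonIdeal I J I~J
        ; inverse   = colonIdeal J I (·-comm I~J)
        ; isInverse =
            proj₁ J.hasRing ∘ ∶·∶⊆∶ (ideal-additive J.ideal) ,
            -- With `1 = Σ p q` in `(J ∶ I)(I ∶ J)`, `s = Σ p (q s)`, and `q s` stays in the
            -- `S`-module `I ∶ J`.
            λ {s} s∈ → 1∈·⇒∈· (·-comm I~J) λ {q} q∈ →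
              FractionalIdeal.resp (colonIdeal J I (·-comm I~J)) (*-comm s q)
                (FractionalIdeal.*-closed (colonIdeal J I (·-comm I~J)) s∈ q∈)
        }

      ~⇒sameOrbit : SameOrbit I J
      ~⇒sameOrbit = colonInvertible ,
        Scaling⇒≅ L▷I J.ideal (≐⇒Scaling L▷I J.ideal
          -- `(J ∶ I) I` equals `J` on the nose, so the scaling factor is 1. For the reverse
          -- inclusion `y = Σ p (q y)`, with `q y` in `I`.
          (∶·⊆ (ideal-additive J.ideal) , λ y∈ → 1∈·⇒∈· (·-comm I~J) λ q∈ → q∈ _ y∈))
        where L▷I = IdealWithRing.ideal (colonInvertible ▷ I)

theorem4p6 : ∀ {c ℓ} (K : CommutativeRing c ℓ) (R : Order K) (S : OverOrder R) →
    let open GroupAction (picAction S) in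
    Free ×
    (∀ I I′ → SameOrbit I I′ ⇔ Setoid._≈_ (𝓦 S) I I′) ×
    (∀ {r s} (I : Fin r → Setoid.Carrier (𝓦 S)) (J : Fin s → Group.Carrier (Pic S)) →
    Enumerates (𝓦 S) I →
    Enumerates (Group.setoid (Pic S)) J →
    Enumerates (ICM S) {Fin r × Fin s} (λ (i , j) → J j ▷ I i))
theorem4p6 K R S =
  picAction-free S ,
  (λ I I′ → mk⇔ (λ (L , iso) → sameOrbit⇒~ S L I I′ iso) (~⇒sameOrbit S I I′)) ,
  λ I J I-enumerates J-enumerates → enumerates-▷ (picAction S) (picAction-free S) _≟_
    {x = I} {g = J}
    -- Orbits are the weak equivalence classes, so the `I i` represent each orbit exactly once.
    (λ X → let i , Iᵢ~X = Enumerates.complete I-enumerates X in i , ~⇒sameOrbit S (I i) X Iᵢ~X)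
    (λ {i} {i′} i≢i′ (L , iso) →
      Enumerates.distinct I-enumerates i≢i′ (sameOrbit⇒~ S L (I i) (I i′) iso))
    J-enumerates
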